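{- HyperPCTL$^*$ subsumes PCTL$^*$: for every PCTL$^*$ state formula $\Phi$ and every path variable $\pi$ there is a HyperPCTL$^*$ formula $\mathcal{T}(\Phi,\pi)$ such that for every DTMC $\mathcal{M}$ and every path assignment $V$, $$\mathcal{M}\models \Phi \iff (\mathcal{M},V)\models \mathcal{T}(\Phi,\pi).$$
   Context: A discrete-time Markov chain (DTMC) is $\mathcal{M}=(S,s_{\mathrm{init}},P,\mathsf{AP},L)$, where $S$ is a finite set of states, $s_{\mathrm{init}}\in S$ is the initial state, $P:S\times S\to[0,1]$ satisfies $\sum_{s'}P(s,s')=1$ for every $s$, $\mathsf{AP}$ is a set of atomic propositions, and $L:S\to 2^{\mathsf{AP}}$ is a labeling. A path is an infinite sequence $\sigma=s(0)s(1)\cdots$ with $P(s(i),s(i+1))\neq 0$ for all $i$; $\sigma^{(i)}=s(i)s(i+1)\cdots$ is its $i$-suffix; paths from a state carry the usual probability measure of the DTMC, and tuples of paths are drawn independently. PCTL$^*$: state formulas $\Phi ::= a \mid \neg\Phi\mid \Phi\wedge\Phi\mid \mathbb{P}^{J}(\varphi)$ and path formulas $\varphi::=\Phi\mid\neg\varphi\mid\varphi\wedge\varphi\mid \mathrm{X}\varphi\mid \varphi\,\mathrm{U}^{\le k}\varphi$, with $a\in\mathsf{AP}$, $J\subseteq[0,1]$ an interval with rational bounds, $k\in\mathbb{N}\cup\{\infty\}$. Semantics: $(\mathcal{M},s)\models a$ iff $a\in L(s)$; Boolean connectives as usual; $(\mathcal{M},s)\models\mathbb{P}^J(\varphi)$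 iff the probability that a random path from $s$ satisfies $\varphi$ lies in $J$; $(\mathcal{M},\sigma)\models\Phi$ iff $(\mathcal{M},\sigma(0))\models\Phi$; $(\mathcal{M},\sigma)\models \mathrm{X}\varphi$ iff $(\mathcal{M},\sigma^{(1)})\models\varphi$; $(\mathcal{M},\sigma)\models\varphi_1\mathrm{U}^{\le k}\varphi_2$ iff there is $i\le k$ with $(\mathcal{M},\sigma^{(i)})\models\varphi_2$ and $(\mathcal{M},\sigma^{(j)})\models\varphi_1$ for all $j<i$. $\mathcal{M}\models\Phi$ means $(\mathcal{M},s_{\mathrm{init}})\models\Phi$. HyperPCTL$^*$: with path variables $\pi$ from an infinite supply $\Pi$, formulas are $\varphi::= a^\pi\mid \varphi^\pi\mid\neg\varphi\mid\varphi\wedge\varphi\mid\mathrm{X}\varphi\mid\varphi\,\mathrm{U}^{\le k}\varphi\mid \rho\bowtie\rho$, $\rho::= f(\rho,\dots,\rho)\mid \mathbb{P}^{\underline\pi}(\varphi)\mid\mathbb{P}^{\underline\pi}(\rho)$, where $\bowtie\in\{<,>,=,\le,\ge\}$, $\underline\pi=(\pi_1,\dots,\pi_n)$ is a tuple of (fresh) path variables, $f$ is an $n$-ary elementary function (constants allowed). A path assignment is $V:\Pi\to\mathrm{Paths}(\mathcal{M})$ (by default paths start at $s_{\mathrm{init}}$); $V^{(i)}(\pi)=(V(\pi))^{(i)}$. Semantics: $(\mathcal{M},V)\models a^\pi$ iff $a\in L(V(\pi)(0))$; $(\mathcal{M},V)\models\varphi^\pi$ iff $\varphi$ holds when every free path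 variable of $\varphi$ is assigned $V(\pi)$; $\neg,\wedge$ as usual; $(\mathcal{M},V)\models\mathrm{X}\varphi$ iff $(\mathcal{M},V^{(1)})\models\varphi$; $(\mathcal{M},V)\models\varphi_1\mathrm{U}^{\le k}\varphi_2$ iff there is $i\le k$ with $(\mathcal{M},V^{(i)})\models\varphi_2$ and $(\mathcal{M},V^{(j)})\models\varphi_1$ for all $j<i$; $(\mathcal{M},V)\models\rho_1\bowtie\rho_2$ iff $[\![\rho_1]\!]_V\bowtie[\![\rho_2]\!]_V$; $[\![f(\rho_1,\dots)]\!]_V=f([\![\rho_1]\!]_V,\dots)$; $[\![\mathbb{P}^{(\pi_1,\dots,\pi_n)}(\varphi)]\!]_V$ is the probability that, for independently drawn random paths $\sigma_i$ starting at $V(\pi_i)(0)$, $(\mathcal{M},V[\pi_i\mapsto\sigma_i\ \forall i])\models\varphi$ (and analogously for $\mathbb{P}^{\underline\pi}(\rho)$). Derived operators $\mathrm{F},\mathrm{G},\vee,\Rightarrow,\mathrm{true}$ as usual. -}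

module Defs where

open import Level using (0ℓ) renaming (suc to lsuc)
open import Algebra.Bundles using (CommutativeRing; Semiring)
import Algebra.Definitions.RawSemiring as RawSemiringDefs
open import Data.Bool.Base using (Bool; if_then_else_)
open import Data.Fin.Base using (Fin; zero; toℕ)
open import Data.Fin.Properties using (any?)
open import Data.Integer.Base using (ℤ; +_; -[1+_])
open import Data.List.Base as List using (List; []; _∷_)
import Data.List.Membership.DecPropositional as DecMembership
open import Data.Maybe.Base using (Maybe; maybe′)
open import Data.Maybe.Relation.Unary.Any using (Any)
open import Data.Nat.Base as ℕ using (ℕ; suc; NonZero; _!)
open import Data.Nat.Divisibility.Core using (_∣_)
open import Data.Product.Base using (Σ; ∃; _×_; _,_)
open import Data.Rational.Base as ℚ using (ℚ; 0ℚ; 1ℚ; ↥_; ↧ₙ_)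
open import Data.Sum.Base using (_⊎_)
open import Data.Unit.Base using (⊤)
open import Data.Vec.Functional using (Vector)
open import Function.Definitions using (Injective)
open import Relation.Binary.Construct.Add.Supremum.NonStrict ℕ._≤_ using (_≤⁺_)
open import Relation.Binary.Core using (Rel)
open import Relation.Binary.Definitions using (DecidableEquality)
open import Relation.Binary.PropositionalEquality.Core using (_≡_; _≢_)
open import Relation.Binary.Structures using (IsTotalOrder)
open import Relation.Nullary.Construct.Add.Supremum using (_⁺; [_])
open import Relation.Nullary.Decidable.Core using (yes; no; does; ¬?)
open import Relation.Nullary.Negation.Core using (¬_)
open import Relation.Unary using (Pred)

module Bounds {A : Set} (_≤_ : Rel A 0ℓ) where
  UpperBound LowerBound IsSup IsInf : Pred A 0ℓ → Pred A 0ℓ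
  UpperBound X u = ∀ x → X x → x ≤ u
  LowerBound X l = ∀ x → X x → l ≤ x
  IsSup X u = UpperBound X u × (∀ v → UpperBound X v → u ≤ v)
  IsInf X l = LowerBound X l × (∀ k → LowerBound X k → k ≤ l)

-- The real numbers, axiomatised as a Dedekind-complete ordered field (which
-- is classically unique up to isomorphism).
record RealField : Set (lsuc 0ℓ) where
  infix 4 _≤_ _<_
  infix 8 _⁻¹

  field
    commutativeRing : CommutativeRing 0ℓ 0ℓ

  open CommutativeRing commutativeRing public hiding (zero)
  open RawSemiringDefs (Semiring.rawSemiring semiring) public
    using (sum; product; _^_) renaming (_×_ to _×#_)

  field
    _≤_          : Rel Carrier 0ℓ
    isTotalOrder : IsTotalOrder _≈_ _≤_

    -- The value of 0# ⁻¹ is unspecified.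
    _⁻¹          : Carrier → Carrier
    0≉1          : ¬ (0# ≈ 1#)
    ⁻¹-inverse   : ∀ x → ¬ (x ≈ 0#) → x * x ⁻¹ ≈ 1#

    +-monoʳ-≤    : ∀ x {y z} → y ≤ z → x + y ≤ x + z
    *-nonNeg     : ∀ {x y} → 0# ≤ x → 0# ≤ y → 0# ≤ x * y

    complete     : ∀ (A : Pred Carrier 0ℓ) → ∃ A → ∃ (Bounds.UpperBound _≤_ A) →
                   ∃ (Bounds.IsSup _≤_ A)

  open Bounds _≤_ public

  _<_ : Rel Carrier 0ℓ
  x < y = x ≤ y × ¬ (x ≈ y)

  fromℕ : ℕ → Carrier
  fromℕ n = n ×# 1#

  fromℤ : ℤ → Carrier
  fromℤ (+ n)    = fromℕ n
  fromℤ -[1+ n ] = - fromℕ (suc n)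

  fromℚ : ℚ → Carrier
  fromℚ q = fromℤ (↥ q) * fromℕ (↧ₙ q) ⁻¹

  infix 4 _⟶_
  _⟶_ : (ℕ → Carrier) → Carrier → Set
  a ⟶ l = ∀ ε → 0# < ε → ∃ λ N → ∀ n → N ℕ.≤ n →
          - ε < a n - l × a n - l < ε

  HasSum : (ℕ → Carrier) → Carrier → Set
  HasSum a t = (λ n → sum {n} (λ k → a (toℕ k))) ⟶ t

-- Elementary functions.  They are partial (1/x, log x, …), so evaluation is
-- a relation.  Powers x ^ y, tan, the hyperbolic functions, ∣x∣, max, … are
-- compositions of the ones below.
module ElementaryFunctions (ℝ : RealField) where
  open RealField ℝ

  data Elementary (n : ℕ) : Set where
    var                   : Fin n → Elementary n
    const                 : Carrier → Elementary n
    add mul div           : Elementary n → Elementary n → Elementary n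
    neg exp log sin cos   : Elementary n → Elementary n
    arcsin arccos arctan  : Elementary n → Elementary n
    root                  : (m : ℕ) → .{{NonZero m}} → Elementary n → Elementary n

  IsExp IsSin IsCos IsArcsin IsArccos IsArctan : Rel Carrier 0ℓ
  IsExp x y = HasSum (λ k → x ^ k * fromℕ (k !) ⁻¹) y
  IsSin x y = HasSum (λ k → (- 1#) ^ k * (x ^ (1 ℕ.+ 2 ℕ.* k) * fromℕ ((1 ℕ.+ 2 ℕ.* k) !) ⁻¹)) y
  IsCos x y = HasSum (λ k → (- 1#) ^ k * (x ^ (2 ℕ.* k) * fromℕ ((2 ℕ.* k) !) ⁻¹)) y

  -- The principal branches [-π/2, π/2], [0, π] and (-π/2, π/2) are singled
  -- out by the sign of cos, respectively sin, on the way from 0 to y.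
  IsArcsin x y = IsSin y x × (∀ t c → (0# ≤ t × t < y) ⊎ (y < t × t ≤ 0#) → IsCos t c → 0# < c)
  IsArccos x y = IsCos y x × 0# ≤ y × (∀ t s → 0# < t → t < y → IsSin t s → 0# < s)
  IsArctan x y = (∃ λ s → ∃ λ c → IsSin y s × IsCos y c × s ≈ x * c) ×
                 (∀ t c → (0# ≤ t × t ≤ y) ⊎ (y ≤ t × t ≤ 0#) → IsCos t c → 0# < c)

  IsRoot : ℕ → Rel Carrier 0ℓ
  IsRoot m x y = y ^ m ≈ x × (2 ∣ m → 0# ≤ y)

  Eval : ∀ {n} → Elementary n → Vector Carrier n → Carrier → Set
  Eval (var i)    xs y = y ≈ xs i
  Eval (const c)  xs y = y ≈ c
  Eval (add e f)  xs y = ∃ λ a → ∃ λ b → Eval e xs a × Eval f xs b × y ≈ a + b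
  Eval (mul e f)  xs y = ∃ λ a → ∃ λ b → Eval e xs a × Eval f xs b × y ≈ a * b
  Eval (div e f)  xs y = ∃ λ a → ∃ λ b → Eval e xs a × Eval f xs b × ¬ (b ≈ 0#) × y * b ≈ a
  Eval (neg e)    xs y = ∃ λ a → Eval e xs a × y ≈ - a
  Eval (exp e)    xs y = ∃ λ a → Eval e xs a × IsExp a y
  Eval (log e)    xs y = ∃ λ a → Eval e xs a × IsExp y a
  Eval (sin e)    xs y = ∃ λ a → Eval e xs a × IsSin a y
  Eval (cos e)    xs y = ∃ λ a → Eval e xs a × IsCos a y
  Eval (arcsin e) xs y = ∃ λ a → Eval e xs a × IsArcsin a y
  Eval (arccos e) xs y = ∃ λ a → Eval e xs a × IsArccos a y
  Eval (arctan e) xs y = ∃ λ a → Eval e xs a × IsArctan a y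
  Eval (root m e) xs y = ∃ λ a → Eval e xs a × IsRoot m a y

record DTMC (ℝ : RealField) (AP : Set) : Set (lsuc 0ℓ) where
  open RealField ℝ
  field
    size : ℕ

  State : Set
  State = Fin size

  field
    init : State
    P    : State → State → Carrier
    0≤P  : ∀ s t → 0# ≤ P s t
    P≤1  : ∀ s t → P s t ≤ 1#
    ∑P≈1 : ∀ s → sum (P s) ≈ 1#
    L    : State → Pred AP 0ℓ

module Paths {ℝ : RealField} {AP : Set} (M : DTMC ℝ AP) where
  open RealField ℝ
  open DTMC M

  record Path : Set where
    field
      at    : ℕ → State
      steps : ∀ i → ¬ (P (at i) (at (suc i)) ≈ 0#)

  open Path public

  start : Path → State
  start σ = at σ 0

  suffix : ℕ → Path → Path
  suffix i σ = record
    { at    = λ j → at σ (j ℕ.+ i)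
    ; steps = λ j → steps σ (j ℕ.+ i)
    }

  -- The cylinder of a word w, among the paths from a state s, consists of the
  -- paths with prefix s w: the word does not include the initial state.
  _∈Cyl_ : Path → List State → Set
  σ ∈Cyl []      = ⊤
  σ ∈Cyl (t ∷ w) = at σ 1 ≡ t × suffix 1 σ ∈Cyl w

  cylProb : State → List State → Carrier
  cylProb s []      = 1#
  cylProb s (t ∷ w) = P s t * cylProb t w

  -- The probability space of n independent paths, the i-th one from s i.
  module _ {n : ℕ} (s : Vector State n) where

    Sample : Set
    Sample = Σ (Vector Path n) λ ω → ∀ i → start (ω i) ≡ s i

    Box : Set
    Box = Vector (List State) n

    _∈Box_ : Vector Path n → Box → Set
    ω ∈Box w = ∀ i → ω i ∈Cyl w i

    boxProb : Box → Carrier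
    boxProb w = product (λ i → cylProb (s i) (w i))

    CoverTotal : Pred (Vector Path n) 0ℓ → Pred Carrier 0ℓ
    CoverTotal A t = ∃ λ (B : ℕ → Maybe Box) →
      (∀ ((ω , _) : Sample) → A ω → ∃ λ k → Any (ω ∈Box_) (B k)) ×
      HasSum (λ k → maybe′ boxProb 0# (B k)) t

    -- The path measure, given by Carathéodory's construction: the outer
    -- measure induced by the probabilities of (products of) cylinders.  It is
    -- the product of the path measures on all measurable sets.
    -- Read Pr A r as "the probability of A is r".
    Pr : Pred (Vector Path n) 0ℓ → Pred Carrier 0ℓ
    Pr A = IsInf (CoverTotal A)

    -- Codes for the sets in the product σ-algebra
    data Event : Set where
      box   : Box → Event
      compl : Event → Event
      union : (ℕ → Event) → Event

    _∈_ : Vector Path n → Event → Set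
    ω ∈ box w   = ω ∈Box w
    ω ∈ compl E = ¬ (ω ∈ E)
    ω ∈ union E = ∃ λ k → ω ∈ E k

    record Simple : Set where
      field
        terms    : ℕ
        coeff    : Vector Carrier terms
        event    : Vector Event terms
        nonNeg   : ∀ i → 0# ≤ coeff i
        disjoint : ∀ i j → i ≢ j → ∀ ((ω , _) : Sample) → ω ∈ event i → ¬ (ω ∈ event j)

    open Simple

    SimpleIntegral : Simple → Pred Carrier 0ℓ
    SimpleIntegral f t = ∃ λ (p : Vector Carrier (terms f)) →
      (∀ i → Pr (_∈ event f i) (p i)) × t ≈ sum (λ i → coeff f i * p i)

    -- Partial random variables are functional relations F.
    -- PositiveIntegral F is the Lebesgue integral of the positive part max(F,0).
    PositiveIntegral : (Vector Path n → Pred Carrier 0ℓ) → Pred Carrier 0ℓ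
    PositiveIntegral F = IsSup λ t → ∃ λ f →
      (∀ i ((ω , _) : Sample) x → ω ∈ event f i → F ω x → coeff f i ≤ x ⊎ coeff f i ≤ 0#) ×
      SimpleIntegral f t

    Expectation : (Vector Path n → Pred Carrier 0ℓ) → Pred Carrier 0ℓ
    Expectation F r =
      Pr (λ ω → ¬ ∃ (F ω)) 0# ×
      ∃ λ p → ∃ λ m → PositiveIntegral F p ×
                      PositiveIntegral (λ ω x → F ω (- x)) m ×
                      r ≈ p - m

ℕ∞ : Set
ℕ∞ = ℕ ⁺

record Interval : Set where
  field
    lower upper             : ℚ
    lowerClosed upperClosed : Bool
    0≤lower                 : 0ℚ ℚ.≤ lower
    lower≤upper             : lower ℚ.≤ upper
    upper≤1                 : upper ℚ.≤ 1ℚ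

module PCTL* (AP : Set) where

  mutual
    data StateFormula : Set where
      atom : AP → StateFormula
      neg  : StateFormula → StateFormula
      and  : StateFormula → StateFormula → StateFormula
      prob : Interval → PathFormula → StateFormula

    data PathFormula : Set where
      state : StateFormula → PathFormula
      neg   : PathFormula → PathFormula
      and   : PathFormula → PathFormula → PathFormula
      next  : PathFormula → PathFormula
      until : ℕ∞ → PathFormula → PathFormula → PathFormula

  module Semantics {ℝ : RealField} (M : DTMC ℝ AP) where
    open RealField ℝ
    open DTMC M
    open Paths M

    _∈Interval_ : Carrier → Interval → Set
    r ∈Interval J =
      (if lowerClosed then fromℚ lower ≤ r else fromℚ lower < r) ×
      (if upperClosed then r ≤ fromℚ upper else r < fromℚ upper)
      where open Interval J

    infix 4 _⊨ˢ_ _⊨ᵖ_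
    mutual
      _⊨ˢ_ : State → StateFormula → Set
      s ⊨ˢ atom a   = L s a
      s ⊨ˢ neg Φ    = ¬ (s ⊨ˢ Φ)
      s ⊨ˢ and Φ Ψ  = s ⊨ˢ Φ × s ⊨ˢ Ψ
      s ⊨ˢ prob J φ = ∃ λ r → Pr {1} (λ _ → s) (λ ω → ω zero ⊨ᵖ φ) r × r ∈Interval J

      _⊨ᵖ_ : Path → PathFormula → Set
      σ ⊨ᵖ state Φ     = start σ ⊨ˢ Φ
      σ ⊨ᵖ neg φ       = ¬ (σ ⊨ᵖ φ)
      σ ⊨ᵖ and φ ψ     = σ ⊨ᵖ φ × σ ⊨ᵖ ψ
      σ ⊨ᵖ next φ      = suffix 1 σ ⊨ᵖ φ
      σ ⊨ᵖ until k φ ψ = ∃ λ i → [ i ] ≤⁺ k × suffix i σ ⊨ᵖ ψ ×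
                                 (∀ j → j ℕ.< i → suffix j σ ⊨ᵖ φ)

    Satisfies : StateFormula → Set
    Satisfies Φ = init ⊨ˢ Φ

module HyperPCTL* (ℝ : RealField) (AP Π : Set) (_≟_ : DecidableEquality Π) where
  open RealField ℝ
  open ElementaryFunctions ℝ
  open DecMembership _≟_ using (_∈?_)

  data Comparison : Set where
    lt gt eq le ge : Comparison

  mutual
    data Formula : Set where
      atom    : AP → Π → Formula
      on      : Formula → Π → Formula            -- φ^π
      neg     : Formula → Formula
      and     : Formula → Formula → Formula
      next    : Formula → Formula
      until   : ℕ∞ → Formula → Formula → Formula
      compare : Comparison → Term → Term → Formula

    data Term : Set where
      apply : ∀ {n} → Elementary n → Vector Term n → Term
      prob  : ∀ {n} (πs : Vector Π (suc n)) → Injective _≡_ _≡_ πs → Formula → Term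
      -- ℙ^π(ρ) averages the value of ρ, as ρ denotes a number and not an event.
      expec : ∀ {n} (πs : Vector Π (suc n)) → Injective _≡_ _≡_ πs → Term → Term

  -- ℙ^π binds the variables π, although its semantics also consults the paths
  -- previously assigned to them for the initial states.
  remove : ∀ {n} → Vector Π n → List Π → List Π
  remove πs = List.filter λ x → ¬? (any? λ i → πs i ≟ x)

  mutual
    free : Formula → List Π
    free (atom a π)      = π ∷ []
    free (on φ π)        = π ∷ []
    free (neg φ)         = free φ
    free (and φ ψ)       = free φ List.++ free ψ
    free (next φ)        = free φ
    free (until k φ ψ)   = free φ List.++ free ψ
    free (compare c ρ τ) = freeᵗ ρ List.++ freeᵗ τ

    freeᵗ : Term → List Π
    freeᵗ (apply f ρs)   = List.concat (List.tabulate λ i → freeᵗ (ρs i))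
    freeᵗ (prob πs _ φ)  = remove πs (free φ)
    freeᵗ (expec πs _ ρ) = remove πs (freeᵗ ρ)

  Holds : Comparison → Rel Carrier 0ℓ
  Holds lt x y = x < y
  Holds gt x y = y < x
  Holds eq x y = x ≈ y
  Holds le x y = x ≤ y
  Holds ge x y = y ≤ x

  module Semantics (M : DTMC ℝ AP) where
    open DTMC M
    open Paths M

    Assignment : Set
    Assignment = Π → Path

    shift : ℕ → Assignment → Assignment
    shift i V π = suffix i (V π)

    _[_↦_] : ∀ {n} → Assignment → Vector Π n → Vector Path n → Assignment
    (V [ πs ↦ ω ]) x with any? (λ i → πs i ≟ x)
    ... | yes (i , _) = ω i
    ... | no _        = V x

    _[_≔_] : Assignment → List Π → Path → Assignment
    (V [ xs ≔ σ ]) x = if does (x ∈? xs) then σ else V x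

    -- ⟦ ρ ⟧ V r reads "the value of ρ under V is defined and equals r".
    -- A comparison of undefined terms is false.
    infix 4 _⊨_
    mutual
      _⊨_ : Assignment → Formula → Set
      V ⊨ atom a π      = L (start (V π)) a
      V ⊨ on φ π        = V [ free φ ≔ V π ] ⊨ φ
      V ⊨ neg φ         = ¬ (V ⊨ φ)
      V ⊨ and φ ψ       = V ⊨ φ × V ⊨ ψ
      V ⊨ next φ        = shift 1 V ⊨ φ
      V ⊨ until k φ ψ   = ∃ λ i → [ i ] ≤⁺ k × shift i V ⊨ ψ ×
                                  (∀ j → j ℕ.< i → shift j V ⊨ φ)
      V ⊨ compare c ρ τ = ∃ λ x → ∃ λ y → ⟦ ρ ⟧ V x × ⟦ τ ⟧ V y × Holds c x y

      ⟦_⟧ : Term → Assignment → Pred Carrier 0ℓ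
      ⟦ apply {n} f ρs ⟧ V r = ∃ λ (xs : Vector Carrier n) →
                                 (∀ i → ⟦ ρs i ⟧ V (xs i)) × Eval f xs r
      ⟦ prob πs _ φ ⟧    V r = Pr (λ i → start (V (πs i))) (λ ω → V [ πs ↦ ω ] ⊨ φ) r
      ⟦ expec πs _ ρ ⟧   V r = Expectation (λ i → start (V (πs i)))
                                           (λ ω → ⟦ ρ ⟧ (V [ πs ↦ ω ])) r

{-# OPTIONS --safe #-}
module Submission where

open import Defs
open import Data.Bool.Base using (Bool; true; false; if_then_else_)
open import Data.Empty using (⊥-elim)
open import Data.Fin.Base using (Fin; zero)
open import Data.Fin.Properties using (any?)
open import Data.Nat.Base using (ℕ)
open import Data.Product.Base using (∃; _×_; _,_)
open import Data.Rational.Base using (ℚ)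
open import Data.Vec.Functional using (Vector)
open import Function.Base using (_∘_)
open import Function.Bundles using (_↣_; _⇔_; mk⇔; module Equivalence)
open import Function.Construct.Identity using (⇔-id)
open import Function.Construct.Symmetry using (⇔-sym)
open import Function.Definitions using (Injective)
open import Level using (0ℓ)
open import Relation.Binary.Definitions using (DecidableEquality)
open import Relation.Binary.PropositionalEquality.Core using (_≡_; refl; subst)
open import Relation.Binary.Structures using (IsTotalOrder)
open import Relation.Nullary.Decidable.Core using (yes; no)
open import Relation.Unary using (Pred)

-- A state formula is read off the first state of the path assigned to π, and
-- ℙ^J(φ) becomes a conjunction of two comparisons of ℙ^π(φ) with the endpoints
-- of J.  Temporal operators shift all paths, and ℙ^π restarts at the current
-- state of π, so the correspondence is proved for all assignments by induction
-- on the formula.  The two comparisons evaluate ℙ^π(φ) separately; they speak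
-- about the same number because infima are unique up to ≈.

open Equivalence using (to; from)

module RealProperties (ℝ : RealField) where
  open RealField ℝ
  open IsTotalOrder isTotalOrder public
    using (antisym; ≤-respˡ-≈; ≤-respʳ-≈)

  <-respˡ-≈ : ∀ {x y z} → x ≈ y → x < z → y < z
  <-respˡ-≈ x≈y (x≤z , x≉z) = ≤-respˡ-≈ x≈y x≤z , x≉z ∘ trans x≈y

  <-respʳ-≈ : ∀ {x y z} → x ≈ y → z < x → z < y
  <-respʳ-≈ x≈y (z≤x , z≉x) =
    ≤-respʳ-≈ x≈y z≤x , λ z≈y → z≉x (trans z≈y (sym x≈y))

  IsInf-unique : ∀ {A x y} → IsInf A x → IsInf A y → x ≈ y
  IsInf-unique (lx , gx) (ly , gy) = antisym (gy _ lx) (gx _ ly)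

  IsInf-cong : ∀ {A B} → (∀ x → A x ⇔ B x) → ∀ {x} → IsInf A x → IsInf B x
  IsInf-cong A⇔B (lower , greatest) =
    (λ y → lower y ∘ from (A⇔B y)) ,
    (λ k k-lower → greatest k λ y → k-lower y ∘ to (A⇔B y))

module MeasureProperties {ℝ : RealField} {AP : Set} (M : DTMC ℝ AP) where
  open RealProperties ℝ
  open DTMC M
  open Paths M

  module _ {n : ℕ} {s : Vector State n} {A B : Pred (Vector Path n) 0ℓ}
           (A⇔B : ∀ ω → A ω ⇔ B ω) where

    -- Only the covering condition mentions the event, so the same sequence of boxes, with the same
    -- total, serves `A` and `B`.
    CoverTotal-cong : ∀ t → CoverTotal s A t ⇔ CoverTotal s B t
    CoverTotal-cong t = mk⇔
      (λ (C , covers , total) → C , (λ ω → covers ω ∘ from (A⇔B _)) , total)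
      (λ (C , covers , total) → C , (λ ω → covers ω ∘ to (A⇔B _)) , total)

    Pr-cong : ∀ {r} → Pr s A r → Pr s B r
    Pr-cong = IsInf-cong CoverTotal-cong

module Translation (ℝ : RealField) (AP Π : Set) (_≟_ : DecidableEquality Π) where
  open RealField ℝ renaming (refl to ≈-refl)
  open RealProperties ℝ
  open ElementaryFunctions ℝ using (const)
  open PCTL* AP using (StateFormula; PathFormula)
  open HyperPCTL* ℝ AP Π _≟_

  module P = PCTL* AP

  constant : ℚ → Term
  constant q = apply {0} (const (fromℚ q)) (λ ())

  -- One choice serves both ends of an interval: the lower endpoint is written on the left of its
  -- comparison, the upper one on the right.
  boundBy : Bool → Comparison
  boundBy closed = if closed then le else lt

  singleton-injective : ∀ {π : Π} → Injective _≡_ _≡_ (λ (_ : Fin 1) → π)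
  singleton-injective {x = zero} {y = zero} _ = refl

  mutual
    translateˢ : StateFormula → Π → Formula
    translateˢ (P.atom a)   π = atom a π
    translateˢ (P.neg Φ)    π = neg (translateˢ Φ π)
    translateˢ (P.and Φ Ψ)  π = and (translateˢ Φ π) (translateˢ Ψ π)
    translateˢ (P.prob J φ) π =
      and (compare (boundBy lowerClosed) (constant lower) ℙφ)
          (compare (boundBy upperClosed) ℙφ (constant upper))
      where
      open Interval J
      -- The index 0 gives a tuple of one variable. Rebinding `π` itself loses nothing: the body
      -- speaks of the sampled path alone, and the old path only supplies the state where sampling
      -- starts.
      ℙφ = prob {0} (λ _ → π) singleton-injective (translateᵖ φ π)

    translateᵖ : PathFormula → Π → Formula
    translateᵖ (P.state Φ)     π = translateˢ Φ π
    translateᵖ (P.neg φ)       π = neg (translateᵖ φ π)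
    translateᵖ (P.and φ ψ)     π = and (translateᵖ φ π) (translateᵖ ψ π)
    translateᵖ (P.next φ)      π = next (translateᵖ φ π)
    translateᵖ (P.until k φ ψ) π = until k (translateᵖ φ π) (translateᵖ ψ π)

  -- Evaluation determines constants and probabilities only up to `≈`, so comparisons must be moved
  -- along it.
  Holds-resp-≈ : ∀ c {x x′ y y′} → x ≈ x′ → y ≈ y′ → Holds c x y → Holds c x′ y′
  Holds-resp-≈ lt p q = <-respˡ-≈ p ∘ <-respʳ-≈ q
  Holds-resp-≈ gt p q = <-respˡ-≈ q ∘ <-respʳ-≈ p
  Holds-resp-≈ eq p q h = trans (sym p) (trans h q)
  Holds-resp-≈ le p q = ≤-respˡ-≈ p ∘ ≤-respʳ-≈ q
  Holds-resp-≈ ge p q = ≤-respˡ-≈ q ∘ ≤-respʳ-≈ p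

  Holds-boundBy : ∀ b {x y} →
    (if b then x ≤ y else x < y) ⇔ Holds (boundBy b) x y
  Holds-boundBy true  = ⇔-id _
  Holds-boundBy false = ⇔-id _

  module Correctness (M : DTMC ℝ AP) where
    open Paths M
    open MeasureProperties M
    open PCTL*.Semantics AP M using (_⊨ˢ_; _⊨ᵖ_)
    open Semantics M

    -- The search by `any?` is stuck on the abstract test `π ≟ π`, so this equation is only
    -- propositional; the single candidate always succeeds.
    update-singleton : ∀ V π (ω : Vector Path 1) → (V [ (λ _ → π) ↦ ω ]) π ≡ ω zero
    update-singleton V π ω with any? {n = 1} (λ _ → π ≟ π)
    ... | yes (zero , _) = refl
    ... | no π≢π         = ⊥-elim (π≢π (zero , refl))

    constant-value : ∀ V q → ⟦ constant q ⟧ V (fromℚ q)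
    constant-value V q = (λ ()) , (λ ()) , ≈-refl

    mutual
      translateˢ-correct : ∀ Φ π V → (start (V π) ⊨ˢ Φ) ⇔ (V ⊨ translateˢ Φ π)
      translateˢ-correct (P.atom a)  π V = ⇔-id _
      translateˢ-correct (P.neg Φ)   π V = mk⇔ (_∘ from ih) (_∘ to ih)
        where ih = translateˢ-correct Φ π V
      translateˢ-correct (P.and Φ Ψ) π V = mk⇔
        (λ (p , q) → to ihΦ p , to ihΨ q)
        (λ (p , q) → from ihΦ p , from ihΨ q)
        where
        ihΦ = translateˢ-correct Φ π V
        ihΨ = translateˢ-correct Ψ π V
      translateˢ-correct (P.prob J φ) π V = mk⇔
        (λ (r , pr , l≤r , r≤u) →
          let pr′ = Pr-cong event⇔ pr in
          (fromℚ lower , r , constant-value V lower , pr′ ,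
            to (Holds-boundBy lowerClosed) l≤r) ,
          (r , fromℚ upper , pr′ , constant-value V upper ,
            to (Holds-boundBy upperClosed) r≤u))
        -- The witness is the value `r` from the lower comparison; the upper bound, known for `r′`,
        -- is carried over to it.
        (λ ((l , r , (_ , _ , l≈lower) , pr , l≤r) ,
            (r′ , u , pr′ , (_ , _ , u≈upper) , r′≤u)) →
          r , Pr-cong (⇔-sym ∘ event⇔) pr ,
          from (Holds-boundBy lowerClosed)
            (Holds-resp-≈ (boundBy lowerClosed) l≈lower ≈-refl l≤r) ,
          from (Holds-boundBy upperClosed)
            (Holds-resp-≈ (boundBy upperClosed) (IsInf-unique pr′ pr) u≈upper r′≤u))
        where
        open Interval J
        event⇔ : ∀ (ω : Vector Path 1) →
          (ω zero ⊨ᵖ φ) ⇔ (V [ (λ _ → π) ↦ ω ] ⊨ translateᵖ φ π)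
        -- The induction hypothesis concerns the path that the updated assignment gives to `π`. The
        -- motive rewrites that path to the sampled one on the left only and leaves the assignment
        -- on the right as it is.
        event⇔ ω = subst (λ σ → (σ ⊨ᵖ φ) ⇔ (V [ (λ _ → π) ↦ ω ] ⊨ translateᵖ φ π))
          (update-singleton V π ω) (translateᵖ-correct φ π (V [ (λ _ → π) ↦ ω ]))

      translateᵖ-correct : ∀ φ π V → (V π ⊨ᵖ φ) ⇔ (V ⊨ translateᵖ φ π)
      translateᵖ-correct (P.state Φ) π V = translateˢ-correct Φ π V
      translateᵖ-correct (P.neg φ)   π V = mk⇔ (_∘ from ih) (_∘ to ih)
        where ih = translateᵖ-correct φ π V
      translateᵖ-correct (P.and φ ψ) π V = mk⇔
        (λ (p , q) → to ihφ p , to ihψ q)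
        (λ (p , q) → from ihφ p , from ihψ q)
        where
        ihφ = translateᵖ-correct φ π V
        ihψ = translateᵖ-correct ψ π V
      -- `shift 1 V π` is `suffix 1 (V π)` by definition, so the hypothesis at the shifted
      -- assignment already has the required type; `until` relies on the same for every shift.
      translateᵖ-correct (P.next φ)      π V = translateᵖ-correct φ π (shift 1 V)
      translateᵖ-correct (P.until k φ ψ) π V = mk⇔
        (λ (i , i≤k , q , p) → i , i≤k , to (ihψ i) q , λ j j<i → to (ihφ j) (p j j<i))
        (λ (i , i≤k , q , p) → i , i≤k , from (ihψ i) q , λ j j<i → from (ihφ j) (p j j<i))
        where
        ihφ = λ j → translateᵖ-correct φ π (shift j V)
        ihψ = λ i → translateᵖ-correct ψ π (shift i V)

theorem1 : (ℝ : RealField) (AP Π : Set) (_≟_ : DecidableEquality Π) → ℕ ↣ Π →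
    (Φ : PCTL*.StateFormula AP) (π : Π) →
    ∃ λ (T : HyperPCTL*.Formula ℝ AP Π _≟_) →
    (M : DTMC ℝ AP) (V : HyperPCTL*.Semantics.Assignment ℝ AP Π _≟_ M) →
    (∀ x → Paths.start M (V x) ≡ DTMC.init M) →
    PCTL*.Semantics.Satisfies AP M Φ ⇔ HyperPCTL*.Semantics._⊨_ ℝ AP Π _≟_ M V T
theorem1 ℝ AP Π _≟_ _ Φ π = translateˢ Φ π , λ M V starts →
  -- Correctness speaks of the first state of `V π`, which `starts` identifies with the initial
  -- state.
  subst (λ s → PCTL*.Semantics._⊨ˢ_ AP M s Φ ⇔ HyperPCTL*.Semantics._⊨_ ℝ AP Π _≟_ M V (translateˢ Φ π))
    (starts π) (Correctness.translateˢ-correct M Φ π V)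
  where open Translation ℝ AP Π _≟_
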